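{- Let $k$ and $r$ be integers with $\frac{k}{2}\le r\le k-3$, and let $G$ be a graph on $n$ vertices. If $e(G)>\frac{(k-1)n}{2}$, then $G$ contains (as a subgraph, not necessarily induced) a keyring with $r$ leaves and at least $k$ edges.
   Context: All graphs are finite, simple and undirected; $e(G)=|E(G)|$ is the number of edges of $G$. A vertex of a graph is a leaf if it has degree one. A keyring with $r\ge 0$ leaves is a graph obtained from a cycle (of length at least 3) by appending $r$ leaves to one of its vertices, i.e., by adding $r$ new vertices, each joined by a single edge to one and the same fixed vertex of the cycle. -}

module Defs where

open import Data.Empty using (⊥)
open import Data.Fin using (Fin; toℕ; splitAt; _<_; _<?_; _≟_)
open import Data.List using (List; length; filter; allFin; cartesianProduct)
open import Data.Nat as ℕ using (ℕ; suc; zero; _+_; _≤_; s≤s)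
open import Data.Nat.Properties using (1+n≢n)
open import Data.Product using (_×_; _,_)
open import Data.Sum using (_⊎_; inj₁; inj₂; swap)
open import Function.Definitions using (Injective)
open import Level using (0ℓ)
open import Relation.Binary.Core using (Rel)
open import Relation.Binary.Definitions using (Symmetric; Irreflexive; Decidable)
open import Relation.Binary.PropositionalEquality using (_≡_; refl; sym)
open import Relation.Nullary using (¬_; no)
open import Relation.Nullary.Decidable using (_×-dec_; _⊎-dec_)

record Graph (n : ℕ) : Set₁ where
  infix 4 _~_ _~?_
  field
    _~_      : Rel (Fin n) 0ℓ
    ~-sym    : Symmetric _~_
    ~-irrefl : Irreflexive _≡_ _~_
    _~?_     : Decidable _~_

-- An edge {u , v} is listed once, as the pair with u < v.
edges : ∀ {n} → Graph n → List (Fin n × Fin n)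
edges {n} G = filter (λ (u , v) → (u <? v) ×-dec (u ~? v))
                     (cartesianProduct (allFin n) (allFin n))
  where open Graph G

e : ∀ {n} → Graph n → ℕ
e G = length (edges G)

infix 4 _⊑_

-- H ⊑ G : G has a (not necessarily induced) subgraph isomorphic to H.
record _⊑_ {m n : ℕ} (H : Graph m) (G : Graph n) : Set where
  private
    module H = Graph H
    module G = Graph G
  field
    embed     : Fin m → Fin n
    injective : Injective _≡_ _≡_ embed
    preserves : ∀ {u v} → u H.~ v → embed u G.~ embed v

-- v is the cyclic successor of u in 0, 1, …, c − 1.
Next : (c : ℕ) → Rel (Fin c) 0ℓ
Next c u v = toℕ v ≡ suc (toℕ u) ⊎ (suc (toℕ u) ≡ c × toℕ v ≡ 0)

next? : ∀ c → Decidable (Next c)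
next? c u v = (toℕ v ℕ.≟ suc (toℕ u)) ⊎-dec
              ((suc (toℕ u) ℕ.≟ c) ×-dec (toℕ v ℕ.≟ 0))

next-irrefl : ∀ {c} → 3 ≤ c → ∀ u → ¬ Next c u u
next-irrefl _ u (inj₁ p) = 1+n≢n (sym p)
next-irrefl {suc zero} (s≤s ()) _ (inj₂ _)
next-irrefl {suc (suc c)} _ u (inj₂ (p , q)) with toℕ u
next-irrefl {suc (suc c)} _ u (inj₂ (() , refl)) | .0

cycle : ∀ {c} → 3 ≤ c → Graph c
cycle {c} 3≤c = record
  { _~_      = λ u v → Next c u v ⊎ Next c v u
  ; ~-sym    = swap
  ; ~-irrefl = λ { {u} refl (inj₁ p) → next-irrefl 3≤c u p
                 ; {u} refl (inj₂ p) → next-irrefl 3≤c u p }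
  ; _~?_     = λ u v → next? c u v ⊎-dec next? c v u
  }

-- The vertices inj₁ u are those of G, the vertices inj₂ i are the new leaves at v.
module _ {n : ℕ} (G : Graph n) (v : Fin n) (r : ℕ) where
  open Graph G

  LeafAdj : Rel (Fin n ⊎ Fin r) 0ℓ
  LeafAdj (inj₁ u) (inj₁ w) = u ~ w
  LeafAdj (inj₁ u) (inj₂ _) = u ≡ v
  LeafAdj (inj₂ _) (inj₁ w) = w ≡ v
  LeafAdj (inj₂ _) (inj₂ _) = ⊥

  leafAdj-sym : Symmetric LeafAdj
  leafAdj-sym {inj₁ _} {inj₁ _} p = ~-sym p
  leafAdj-sym {inj₁ _} {inj₂ _} p = p
  leafAdj-sym {inj₂ _} {inj₁ _} p = p

  leafAdj-irrefl : ∀ x → ¬ LeafAdj x x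
  leafAdj-irrefl (inj₁ _) p = ~-irrefl refl p

  leafAdj? : Decidable LeafAdj
  leafAdj? (inj₁ u) (inj₁ w) = u ~? w
  leafAdj? (inj₁ u) (inj₂ _) = u ≟ v
  leafAdj? (inj₂ _) (inj₁ w) = w ≟ v
  leafAdj? (inj₂ _) (inj₂ _) = no λ ()

  appendLeaves : Graph (n + r)
  appendLeaves = record
    { _~_      = λ x y → LeafAdj (splitAt n x) (splitAt n y)
    ; ~-sym    = λ {x} {y} → leafAdj-sym {splitAt n x} {splitAt n y}
    ; ~-irrefl = λ { {x} refl → leafAdj-irrefl (splitAt n x) }
    ; _~?_     = λ x y → leafAdj? (splitAt n x) (splitAt n y)
    }

keyring : ∀ {c} → 3 ≤ c → Fin c → (r : ℕ) → Graph (c + r)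
keyring 3≤c v r = appendLeaves (cycle 3≤c) v r

{-# OPTIONS --safe #-}
module Submission where

-- Put K = k − 1 and s = k − r ≤ r, and let U be a minimal vertex set whose degree sum exceeds
-- K (|U| − 1).  Minimality makes the graph on U 2-connected, with all degrees above K/2, hence
-- at least s; and some v has degree at least K.  In a 2-connected graph of minimum degree s any
-- two vertices are joined by a path of length at least s, so there is such a path from v to a
-- neighbour of v.  Cut it at the first neighbour of v at distance at least s − 1 along the path:
-- the cycle obtained has length at least s and contains at most s − 1 neighbours of v, so that
-- at least K − (s − 1) = r neighbours of v remain for the leaves.

open import Defs
open import Data.Bool using (true; false)
open import Data.Fin as Fin using (Fin; zero; suc; _≟_; toℕ; splitAt; join; fromℕ; inject₁)
import Data.Fin.Properties as FinP
open import Data.Fin.Subset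
  using (Subset; _∈_; _∉_; _⊆_; _⊂_; _∪_; _─_; _-_; ∁; ⁅_⁆; Nonempty; ⊤)
open import Data.Fin.Subset.Induction using (⊂-wellFounded; Acc; acc)
open import Data.Fin.Subset.Properties
open import Data.List as List
  using (List; []; _∷_; _++_; length; filter; map; cartesianProduct; tabulate)
open import Data.List.Membership.Propositional using () renaming (_∈_ to _∈ˡ_)
open import Data.List.Membership.Propositional.Properties
  using (∈-filter⁺; ∈-cartesianProduct⁺; ∈-allFin)
open import Data.List.Properties using (filter-++; length-++)
open import Data.List.Relation.Unary.Any using (index)
open import Data.List.Relation.Unary.Any.Properties using (lookup-index)
open import Data.Nat using (ℕ; zero; suc; _+_; _*_; _∸_; _≤_; _<_; z≤n; s≤s; _≤?_)
open import Data.Nat.Properties hiding (_≟_)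
open import Data.Product using (∃; ∃-syntax; Σ-syntax; _×_; _,_; proj₁; proj₂)
open import Data.Product.Properties using (,-injective)
open import Data.Sum using (_⊎_; inj₁; inj₂; [_,_]′)
open import Data.Vec as Vec using ()
open import Data.Vec.Properties using (lookup∘tabulate; []=⇒lookup; lookup⇒[]=)
open import Function using (_∘_; id)
open import Function.Definitions using (Injective)
open import Level using (0ℓ)
open import Relation.Binary.PropositionalEquality
open import Relation.Nullary using (¬_; Dec; yes; no; does; contradiction)
open import Relation.Nullary.Decidable
  using (_×-dec_; _⊎-dec_; _→-dec_; ¬?; map′; dec-true; dec-false; decidable-stable)
open import Relation.Unary using (Pred; Decidable)
open import Algebra.Properties.CommutativeMonoid.Sum +-0-commutativeMonoid
  using (sum; sum-cong-≗; ∑-distrib-+; ∑-comm; sum-replicate-zero)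

private variable
  m n : ℕ
  A B : Set
  P Q R : Set

-- Counting by sums of indicators.

𝟙 : Dec P → ℕ
𝟙 (yes _) = 1
𝟙 (no  _) = 0

𝟙≤1 : (P? : Dec P) → 𝟙 P? ≤ 1
𝟙≤1 (yes _) = ≤-refl
𝟙≤1 (no  _) = z≤n

𝟙-mono : (P? : Dec P) (Q? : Dec Q) → (P → Q) → 𝟙 P? ≤ 𝟙 Q?
𝟙-mono (no _)  _      _ = z≤n
𝟙-mono (yes p) (yes _) _ = ≤-refl
𝟙-mono (yes p) (no ¬q) f = contradiction (f p) ¬q

𝟙-⊎ : (P? : Dec P) (Q? : Dec Q) (R? : Dec R) → (P → Q ⊎ R) → 𝟙 P? ≤ 𝟙 Q? + 𝟙 R?
𝟙-⊎ (no _)  _ _ _ = z≤n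
𝟙-⊎ (yes p) Q? R? f with f p
... | inj₁ q = ≤-trans (𝟙-mono (yes p) Q? (λ _ → q)) (m≤m+n _ _)
... | inj₂ r = ≤-trans (𝟙-mono (yes p) R? (λ _ → r)) (m≤n+m _ _)

𝟙-disjoint : {P Q R : Set} (P? : Dec P) (Q? : Dec Q) (R? : Dec R) →
             (P → ¬ Q) → (P → R) → (Q → R) → 𝟙 P? + 𝟙 Q? ≤ 𝟙 R?
𝟙-disjoint (no _)  Q?      R? _    _ g = 𝟙-mono Q? R? g
𝟙-disjoint (yes p) (no _)  R? _    f _ = 𝟙-mono (yes p) R? f
𝟙-disjoint (yes p) (yes q) R? disj _ _ = contradiction q (disj p)

sum-mono : (f g : Fin n → ℕ) → (∀ i → f i ≤ g i) → sum f ≤ sum g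
sum-mono {zero}  f g h = z≤n
sum-mono {suc n} f g h = +-mono-≤ (h zero) (sum-mono (f ∘ suc) (g ∘ suc) (h ∘ suc))

sum-≤-+ : (f g h : Fin n → ℕ) → (∀ i → f i ≤ g i + h i) → sum f ≤ sum g + sum h
sum-≤-+ f g h le = ≤-trans (sum-mono f _ le) (≤-reflexive (∑-distrib-+ g h))

sum-+-≤ : (f g h : Fin n → ℕ) → (∀ i → f i + g i ≤ h i) → sum f + sum g ≤ sum h
sum-+-≤ f g h le = ≤-trans (≤-reflexive (sym (∑-distrib-+ f g))) (sum-mono _ h le)

sum-zero : (f : Fin n → ℕ) → (∀ i → f i ≡ 0) → sum f ≡ 0
sum-zero {n} f h = trans (sum-cong-≗ h) (sum-replicate-zero n)

sum-const-* : (f : Fin n → ℕ) (q : ℕ) → sum (λ i → f i * q) ≡ sum f * q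
sum-const-* {zero}  f q = refl
sum-const-* {suc n} f q =
  trans (cong (f zero * q +_) (sum-const-* (f ∘ suc) q)) (sym (*-distribʳ-+ q (f zero) _))

count : {P : Pred (Fin n) 0ℓ} → Decidable P → ℕ
count P? = sum (𝟙 ∘ P?)

module _ {P Q : Pred (Fin n) 0ℓ} (P? : Decidable P) (Q? : Decidable Q) where

  count-mono : (∀ {i} → P i → Q i) → count P? ≤ count Q?
  count-mono h = sum-mono _ _ λ i → 𝟙-mono (P? i) (Q? i) h

  count-⊎ : {R : Pred (Fin n) 0ℓ} (R? : Decidable R) →
            (∀ {i} → P i → Q i ⊎ R i) → count P? ≤ count Q? + count R?
  count-⊎ R? h = sum-≤-+ _ _ _ λ i → 𝟙-⊎ (P? i) (Q? i) (R? i) h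

count-empty : {P : Pred (Fin n) 0ℓ} (P? : Decidable P) → (∀ i → ¬ P i) → count P? ≡ 0
count-empty P? h = sum-zero _ λ i → n≤0⇒n≡0 (𝟙-mono (P? i) (no id) (h i))

count-witness : {P : Pred (Fin n) 0ℓ} (P? : Decidable P) → 1 ≤ count P? → ∃ P
count-witness P? 1≤ with FinP.any? P?
... | yes p = p
... | no ¬p = contradiction (subst (1 ≤_) (count-empty P? λ i p → ¬p (i , p)) 1≤) λ ()

count-unique : {P : Pred (Fin n) 0ℓ} (P? : Decidable P) (x : Fin n) →
               (∀ {i} → P i → i ≡ x) → count P? ≤ 1
count-unique {suc n} P? zero h = +-mono-≤ {y = 1} (𝟙≤1 (P? zero))
  (≤-reflexive (count-empty (P? ∘ suc) λ i p → contradiction (h p) λ ()))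
count-unique {suc n} P? (suc x) h = +-mono-≤ {y = 0} {v = 1}
  (𝟙-mono (P? zero) (no id) λ p → contradiction (h p) λ ())
  (count-unique (P? ∘ suc) x (FinP.suc-injective ∘ h))

count-≥1 : {P : Pred (Fin n) 0ℓ} (P? : Decidable P) (x : Fin n) → P x → 1 ≤ count P?
count-≥1 P? zero    p = ≤-trans (𝟙-mono (yes p) (P? zero) (λ _ → p)) (m≤m+n _ _)
count-≥1 P? (suc x) p = ≤-trans (count-≥1 (P? ∘ suc) x p) (m≤n+m _ (𝟙 (P? zero)))

count-disjoint : {P Q R : Pred (Fin n) 0ℓ} (P? : Decidable P) (Q? : Decidable Q) (R? : Decidable R) →
                 (∀ {i} → P i → ¬ Q i) → (∀ {i} → P i → R i) → (∀ {i} → Q i → R i) →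
                 count P? + count Q? ≤ count R?
count-disjoint P? Q? R? disj f g =
  sum-+-≤ _ _ _ λ i → 𝟙-disjoint (P? i) (Q? i) (R? i) disj f g

count≤n : {P : Pred (Fin n) 0ℓ} (P? : Decidable P) → count P? ≤ n
count≤n {zero}  P? = z≤n
count≤n {suc n} P? = +-mono-≤ (𝟙≤1 (P? zero)) (count≤n (P? ∘ suc))

count-× : {P : Set} {Q : Pred (Fin n) 0ℓ} (P? : Dec P) (Q? : Decidable Q) →
          count (λ i → P? ×-dec Q? i) ≤ 𝟙 P? * count Q?
count-× (no ¬p) Q? = ≤-reflexive (count-empty (λ i → no ¬p ×-dec Q? i) λ _ → ¬p ∘ proj₁)
count-× (yes p) Q? = ≤-trans (count-mono (λ i → yes p ×-dec Q? i) Q? proj₂)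
                             (≤-reflexive (sym (*-identityˡ _)))

-- Turns a lower bound on a count into distinct witnesses; the leaves of the keyring are chosen this
-- way.
count-embed : {P : Pred (Fin n) 0ℓ} (P? : Decidable P) → m ≤ count P? →
              ∃[ g ] (Injective _≡_ _≡_ g × ∀ (i : Fin m) → P (g i))
count-embed {m = zero} P? _ = (λ ()) , (λ { {()} }) , λ ()
count-embed {n = suc n} {m = suc m} P? le with P? zero
count-embed {n = suc n} {m = suc m} P? (s≤s le) | yes p with count-embed (P? ∘ suc) le
... | g , g-inj , Pg = g′ , g′-inj , Pg′
  where
  g′ : Fin (suc m) → Fin (suc n)
  g′ zero    = zero
  g′ (suc i) = suc (g i)
  g′-inj : Injective _≡_ _≡_ g′
  g′-inj {zero}  {zero}  _  = refl
  g′-inj {suc i} {suc j} eq = cong suc (g-inj (FinP.suc-injective eq))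
  Pg′ : ∀ i → _
  Pg′ zero    = p
  Pg′ (suc i) = Pg i
count-embed {n = suc n} {m = suc m} P? le | no _ with count-embed (P? ∘ suc) le
... | g , g-inj , Pg = suc ∘ g , g-inj ∘ FinP.suc-injective , Pg

-- Lengths of filtered lists.

length-filter-tabulate : {P : Pred A 0ℓ} (P? : Decidable P) (f : Fin n → A) →
                         length (filter P? (tabulate f)) ≡ count (P? ∘ f)
length-filter-tabulate {n = zero}  P? f = refl
length-filter-tabulate {n = suc n} P? f with P? (f zero)
... | yes _ = cong suc (length-filter-tabulate P? (f ∘ suc))
... | no  _ = length-filter-tabulate P? (f ∘ suc)

length-filter-map : {P : Pred B 0ℓ} (P? : Decidable P) (f : A → B) (xs : List A) →
                    length (filter P? (map f xs)) ≡ length (filter (P? ∘ f) xs)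
length-filter-map P? f []       = refl
length-filter-map P? f (x ∷ xs) with does (P? (f x))
... | true  = cong suc (length-filter-map P? f xs)
... | false = length-filter-map P? f xs

-- Translates the list behind `e` into a double sum of indicators, whose order of summation can be
-- exchanged.
length-filter-cartesianProduct :
  {P : Pred (A × B) 0ℓ} (P? : Decidable P) (f : Fin m → A) (g : Fin n → B) →
  length (filter P? (cartesianProduct (tabulate f) (tabulate g)))
    ≡ sum (λ i → count (λ j → P? (f i , g j)))
length-filter-cartesianProduct {m = zero}  P? f g = refl
length-filter-cartesianProduct {m = suc m} P? f g = begin
  length (filter P? (map (f zero ,_) ys ++ rest))
    ≡⟨ cong length (filter-++ P? (map (f zero ,_) ys) rest) ⟩
  length (filter P? (map (f zero ,_) ys) ++ filter P? rest)
    ≡⟨ length-++ (filter P? (map (f zero ,_) ys)) ⟩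
  length (filter P? (map (f zero ,_) ys)) + length (filter P? rest)
    ≡⟨ cong₂ _+_ (trans (length-filter-map P? (f zero ,_) ys)
                        (length-filter-tabulate (P? ∘ (f zero ,_)) g))
                 (length-filter-cartesianProduct P? (f ∘ suc) g) ⟩
  _ ∎
  where
  open ≡-Reasoning
  ys = tabulate g
  rest = cartesianProduct (tabulate (f ∘ suc)) ys

-- Finite subsets and minimal ones among them.

x∈p─q⇒x∉q : {p q : Subset n} {x : Fin n} → x ∈ p ─ q → x ∉ q
x∈p─q⇒x∉q {p = p} {q} {x} x∈p─q x∈q =
  ∉⊥ (subst (x ∈_) (trans (p─q─r≡p─q∪r p q (∁ q)) (trans (cong (p ─_) (p∪∁p≡⊤ q)) (p─⊤≡⊥ p)))
       (x∈p∧x∉q⇒x∈p─q x∈p─q (x∈p⇒x∉∁p x∈q)))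

x∈p-y⇒x∈p : {p : Subset n} {x y : Fin n} → x ∈ p - y → x ∈ p
x∈p-y⇒x∈p {p = p} = p─q⊆p p _

x∈p-y⇒x≢y : {p : Subset n} {x y : Fin n} → x ∈ p - y → x ≢ y
x∈p-y⇒x≢y x∈ = x∉⁅y⁆⇒x≢y (x∈p─q⇒x∉q x∈)

p⊆q⇒p-x⊆q-x : {p q : Subset n} {x : Fin n} → p ⊆ q → p - x ⊆ q - x
p⊆q⇒p-x⊆q-x p⊆q u∈ = x∈p∧x≢y⇒x∈p-y (p⊆q (x∈p-y⇒x∈p u∈)) (x∈p-y⇒x≢y u∈)

x∈p∪⁅y⁆⁻ : (p : Subset n) {x y : Fin n} → x ∈ p ∪ ⁅ y ⁆ → x ∈ p ⊎ x ≡ y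
x∈p∪⁅y⁆⁻ p x∈ with x∈p∪q⁻ p _ x∈
... | inj₁ x∈p = inj₁ x∈p
... | inj₂ x∈y = inj₂ (x∈⁅y⁆⇒x≡y _ x∈y)

x∈p∪⁅y⁆⁺ : {p : Subset n} {x y : Fin n} → x ∈ p ⊎ x ≡ y → x ∈ p ∪ ⁅ y ⁆
x∈p∪⁅y⁆⁺ (inj₁ x∈p)  = x∈p∪q⁺ (inj₁ x∈p)
x∈p∪⁅y⁆⁺ (inj₂ refl) = x∈p∪q⁺ (inj₂ (x∈⁅x⁆ _))

module _ {P : Pred (Fin n) 0ℓ} (P? : Decidable P) where

  ⟦_⟧ : Subset n
  ⟦_⟧ = Vec.tabulate (does ∘ P?)

  ∈⟦⟧⁺ : ∀ {x} → P x → x ∈ ⟦_⟧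
  ∈⟦⟧⁺ {x} p = lookup⇒[]= x _ (trans (lookup∘tabulate _ x) (dec-true (P? x) p))

  ∈⟦⟧⁻ : ∀ {x} → x ∈ ⟦_⟧ → P x
  ∈⟦⟧⁻ {x} x∈ = decidable-stable (P? x) λ ¬p →
    contradiction (trans (sym (dec-false (P? x) ¬p)) (trans (sym (lookup∘tabulate _ x)) ([]=⇒lookup x∈)))
      λ ()

Minimal : Pred (Subset n) 0ℓ → Pred (Subset n) 0ℓ
Minimal P S = P S × (∀ {T} → T ⊂ S → ¬ P T)

minimal-exists : {P : Pred (Subset n) 0ℓ} → Decidable P → ∀ {S} → P S → ∃ (Minimal P)
minimal-exists {n} {P} P? {S} = go (⊂-wellFounded S)
  where
  go : ∀ {S} → Acc _⊂_ S → P S → ∃ (Minimal P)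
  go {S} (acc rs) p with anySubset? (λ T → T ⊂? S ×-dec P? T)
  ... | yes (T , T⊂S , q) = go (rs T⊂S) q
  ... | no ∄ = S , p , λ T⊂S q → ∄ (_ , T⊂S , q)

-- Paths and reachability.

module _ (G : Graph n) where
  open Graph G

  -- The start is deleted from the set available to the rest, so every path is simple by
  -- construction. The last index counts edges.
  data Path (U : Subset n) : Fin n → Fin n → ℕ → Set where
    [_]    : ∀ {x} → x ∈ U → Path U x x 0
    _~⟨_⟩_ : ∀ {x y z m} → x ∈ U → x ~ y → Path (U - x) y z m → Path U x z (suc m)

  source∈ : ∀ {U x z m} → Path U x z m → x ∈ U
  source∈ [ x∈U ]         = x∈U
  source∈ (x∈U ~⟨ _ ⟩ _) = x∈U

  target∈ : ∀ {U x z m} → Path U x z m → z ∈ U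
  target∈ [ x∈U ]       = x∈U
  target∈ (_ ~⟨ _ ⟩ p) = x∈p-y⇒x∈p (target∈ p)

  path-⊆ : ∀ {U V x z m} → U ⊆ V → Path U x z m → Path V x z m
  path-⊆ U⊆V [ x∈U ]           = [ U⊆V x∈U ]
  path-⊆ U⊆V (x∈U ~⟨ x~y ⟩ p) = U⊆V x∈U ~⟨ x~y ⟩ path-⊆ (p⊆q⇒p-x⊆q-x U⊆V) p

  path-++ : ∀ {U V x y z l m} → (∀ {u} → u ∈ U → u ∈ V → u ≡ y) →
            Path U x y l → Path V y z m → Path (U ∪ V) x z (l + m)
  path-++ disj [ _ ] q = path-⊆ (q⊆p∪q _ _) q
  path-++ {U} {V} {x} disj (x∈U ~⟨ x~x′ ⟩ p) q =
    x∈p∪q⁺ (inj₁ x∈U) ~⟨ x~x′ ⟩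
    path-⊆ sub (path-++ (λ u∈U u∈V → disj (x∈p-y⇒x∈p u∈U) u∈V) p q)
    where
    sub : (U - x) ∪ V ⊆ U ∪ V - x
    sub {u} u∈ with x∈p∪q⁻ (U - x) V u∈
    ... | inj₁ u∈U = x∈p∧x≢y⇒x∈p-y (x∈p∪q⁺ (inj₁ (x∈p-y⇒x∈p u∈U))) (x∈p-y⇒x≢y u∈U)
    -- If `x` were in `V` it would be the meeting vertex `y`, but `y` ends `p`, which avoids `x`.
    ... | inj₂ u∈V = x∈p∧x≢y⇒x∈p-y (x∈p∪q⁺ (inj₂ u∈V))
      λ { refl → x∈p-y⇒x≢y (target∈ p) (sym (disj x∈U u∈V)) }

  Reachable : Subset n → Fin n → Fin n → Set
  Reachable U x z = ∃ (Path U x z)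

  -- If `z` already lies on the path, the path is cut there; hence the length of the result is left
  -- open.
  reachable-step : ∀ {U x y z m} → Path U x y m → y ~ z → z ∈ U → Reachable U x z
  reachable-step {x = x} {z = z} p y~z z∈U with z ≟ x
  ... | yes refl = _ , [ z∈U ]
  reachable-step [ x∈U ] x~z z∈U | no z≢x = _ , x∈U ~⟨ x~z ⟩ [ x∈p∧x≢y⇒x∈p-y z∈U z≢x ]
  reachable-step (x∈U ~⟨ x~y ⟩ p) y~z z∈U | no z≢x =
    _ , x∈U ~⟨ x~y ⟩ proj₂ (reachable-step p y~z (x∈p∧x≢y⇒x∈p-y z∈U z≢x))

  reachable? : ∀ U x z → Dec (Reachable U x z)
  reachable? U = go (⊂-wellFounded U)
    where
    go : ∀ {U} → Acc _⊂_ U → ∀ x z → Dec (Reachable U x z)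
    go {U} (acc rs) x z with x ∈? U | x ≟ z
    ... | no x∉U  | _        = no (x∉U ∘ source∈ ∘ proj₂)
    ... | yes x∈U | yes refl = yes (_ , [ x∈U ])
    ... | yes x∈U | no x≢z   = map′
      (λ (y , x~y , _ , p) → _ , x∈U ~⟨ x~y ⟩ p)
      (λ { (_ , [ _ ]) → contradiction refl x≢z
         ; (_ , _ ~⟨ x~y ⟩ p) → _ , x~y , _ , p })
      (FinP.any? λ y → (x ~? y) ×-dec go (rs (x∈p⇒p-x⊂p x∈U)) y z)

  component : Subset n → Fin n → Subset n
  component U x = ⟦ reachable? U x ⟧

  component-closed : ∀ U x {u w} → u ∈ component U x → u ~ w → w ∈ U → w ∈ component U x
  component-closed U x u∈ u~w w∈U =
    ∈⟦⟧⁺ (reachable? U x) (reachable-step (proj₂ (∈⟦⟧⁻ (reachable? U x) u∈)) u~w w∈U)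

  -- Separations, degrees and long paths.

  -- Equivalently, `B` is a nonempty union of components of the graph on `U - b`. It may be all of
  -- `U - b`, so `b` need not be a cut vertex.
  record Sep (U B : Subset n) (b : Fin n) : Set where
    constructor sep
    field
      nonempty : Nonempty B
      B⊆U      : B ⊆ U
      b∈U      : b ∈ U
      b∉B      : b ∉ B
      closed   : ∀ {u w} → u ∈ B → w ∈ U → u ~ w → w ∈ B ⊎ w ≡ b

  sep? : ∀ U B b → Dec (Sep U B b)
  sep? U B b = map′ to from
    (nonempty? B ×-dec (B ⊆? U) ×-dec (b ∈? U) ×-dec ¬? (b ∈? B) ×-dec
      FinP.all? λ u → (u ∈? B) →-dec FinP.all? λ w → (w ∈? U) →-dec (u ~? w) →-dec
        ((w ∈? B) ⊎-dec (w ≟ b)))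
    where
    Conditions : Set
    Conditions = Nonempty B × B ⊆ U × b ∈ U × b ∉ B ×
      (∀ u → u ∈ B → ∀ w → w ∈ U → u ~ w → w ∈ B ⊎ w ≡ b)
    to : Conditions → Sep U B b
    to (ne , sub , b∈ , b∉ , cl) = sep ne sub b∈ b∉ λ {u} {w} u∈ w∈ → cl u u∈ w w∈
    from : Sep U B b → Conditions
    from (sep ne sub b∈ b∉ cl) = ne , sub , b∈ , b∉ , λ u u∈ w w∈ → cl u∈ w∈

  -- For |U| ≥ 3 this says, whatever y is, that the graph induced on U is 2-connected.
  Tight : Subset n → Fin n → Set
  Tight U y = ∀ {B b} → Sep U B b → y ∉ B → U - y ⊆ B

  adjacentIn? : ∀ U u → Decidable (λ w → w ∈ U × u ~ w)
  adjacentIn? U u w = (w ∈? U) ×-dec (u ~? w)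

  deg : Subset n → Fin n → ℕ
  deg U u = count (adjacentIn? U u)

  deg-remove : ∀ U u x → deg U u ≤ suc (deg (U - x) u)
  deg-remove U u x = ≤-trans
    (count-⊎ (adjacentIn? U u) (_≟ x) (adjacentIn? (U - x) u) split)
    (+-mono-≤ (count-unique (_≟ x) x id) ≤-refl)
    where
    split : ∀ {w} → w ∈ U × u ~ w → w ≡ x ⊎ (w ∈ U - x × u ~ w)
    split {w} (w∈U , u~w) with w ≟ x
    ... | yes w≡x = inj₁ w≡x
    ... | no  w≢x = inj₂ (x∈p∧x≢y⇒x∈p-y w∈U w≢x , u~w)

  -- The vertex `y` is exempt because in the induction its role passes to the separating vertex `b`,
  -- which may lose neighbours when `U` shrinks to `B ∪ ⁅ b ⁆`.
  MinDegreeOff : Subset n → Fin n → ℕ → Set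
  MinDegreeOff U y d = ∀ {u} → u ∈ U → u ≢ y → d ≤ deg U u

  Path≥ : Subset n → Fin n → Fin n → ℕ → Set
  Path≥ U x y d = ∃[ m ] (d ≤ m × Path U x y m)

  -- If `y` were unreachable, `x` would separate from `y` the rest of its own component, which is
  -- nonempty by the degree condition; tightness would then place `x` in that rest.
  tight-connected : ∀ {U x y} → Tight U y → x ∈ U → y ∈ U → x ≢ y → 1 ≤ deg U x → Path≥ U x y 1
  tight-connected {U} {x} {y} tight x∈U y∈U x≢y 1≤deg with reachable? U x y
  ... | yes (_ , [ _ ])                = contradiction refl x≢y
  ... | yes (_ , x∈U ~⟨ x~w ⟩ p)      = _ , s≤s z≤n , x∈U ~⟨ x~w ⟩ p
  ... | no unreachable with count-witness (adjacentIn? U x) 1≤deg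
  ... | w , w∈U , x~w = contradiction (tight sep-x y∉ (x∈p∧x≢y⇒x∈p-y x∈U x≢y)) λ x∈ → x∈p-y⇒x≢y x∈ refl
    where
    D = component U x
    x∈D : x ∈ D
    x∈D = ∈⟦⟧⁺ (reachable? U x) (_ , [ x∈U ])
    D⊆U : D ⊆ U
    D⊆U = target∈ ∘ proj₂ ∘ ∈⟦⟧⁻ (reachable? U x)
    y∉ : y ∉ D - x
    y∉ = unreachable ∘ ∈⟦⟧⁻ (reachable? U x) ∘ x∈p-y⇒x∈p
    closed : ∀ {u w} → u ∈ D - x → w ∈ U → u ~ w → w ∈ D - x ⊎ w ≡ x
    closed {u} {w} u∈ w∈U u~w with w ≟ x
    ... | yes w≡x = inj₂ w≡x
    ... | no  w≢x = inj₁ (x∈p∧x≢y⇒x∈p-y (component-closed U x (x∈p-y⇒x∈p u∈) u~w w∈U) w≢x)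
    sep-x : Sep U (D - x) x
    sep-x = sep (w , x∈p∧x≢y⇒x∈p-y (component-closed U x x∈D x~w w∈U) λ w≡x → ~-irrefl (sym w≡x) x~w)
                (D⊆U ∘ x∈p-y⇒x∈p) x∈U (λ x∈ → x∈p-y⇒x≢y x∈ refl) closed

  -- Delete x, and let B be a minimal part that a vertex b separates from y in what remains.  Then
  -- B ∪ {b} is again 2-connected, x has a neighbour x′ in B, and b reaches y outside B: prolong the
  -- path from x′ to b given by induction at both ends.
  long-path : ∀ d {U x y} → Tight U y → y ∈ U → MinDegreeOff U y (suc d) → x ∈ U → x ≢ y →
              Path≥ U x y (suc d)
  long-path zero tight y∈U mindeg x∈U x≢y =
    tight-connected tight x∈U y∈U x≢y (mindeg x∈U x≢y)
  long-path (suc d) {U} {x} {y} tight y∈U mindeg x∈U x≢y =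
    extend (minimal-exists separated? (sep-y , y∉U′-y))
    where
    U′ = U - x

    y∈U′ : y ∈ U′
    y∈U′ = x∈p∧x≢y⇒x∈p-y y∈U (x≢y ∘ sym)

    Separated : Pred (Subset n) 0ℓ
    Separated B = (∃[ b ] Sep U′ B b) × y ∉ B
    separated? : Decidable Separated
    separated? B = FinP.any? (sep? U′ B) ×-dec ¬? (y ∈? B)

    y∉U′-y : y ∉ U′ - y
    y∉U′-y y∈ = x∈p-y⇒x≢y y∈ refl

    nbr≢y : ∃[ w ] (w ∈ U - y × x ~ w)
    nbr≢y = count-witness (adjacentIn? (U - y) x)
      (≤-trans (s≤s z≤n) (≤-pred (≤-trans (mindeg x∈U x≢y) (deg-remove U x y))))

    -- The descent to a minimal part starts from all of `U′` but `y`, separated by `y` itself; the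
    -- final `b` may thus be `y`.
    sep-y : ∃[ b ] Sep U′ (U′ - y) b
    sep-y = y , sep (proj₁ nbr≢y , x∈p∧x≢y⇒x∈p-y w∈U′ (x∈p-y⇒x≢y w∈)) x∈p-y⇒x∈p y∈U′ y∉U′-y closed
      where
      w∈ = proj₁ (proj₂ nbr≢y)
      x~w = proj₂ (proj₂ nbr≢y)
      w∈U′ = x∈p∧x≢y⇒x∈p-y (x∈p-y⇒x∈p w∈) λ w≡x → ~-irrefl (sym w≡x) x~w
      closed : ∀ {u w} → u ∈ U′ - y → w ∈ U′ → u ~ w → w ∈ U′ - y ⊎ w ≡ y
      closed {w = w} _ w∈U′ _ with w ≟ y
      ... | yes w≡y = inj₂ w≡y
      ... | no  w≢y = inj₁ (x∈p∧x≢y⇒x∈p-y w∈U′ w≢y)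

    extend : ∃ (Minimal Separated) → Path≥ U x y (suc (suc d))
    extend (B , ((b , sepB@(sep ne B⊆U′ b∈U′ b∉B closed)) , y∉B) , minimal) = result
      where
      U″ = B ∪ ⁅ b ⁆

      U″⊆U′ : U″ ⊆ U′
      U″⊆U′ u∈ with x∈p∪⁅y⁆⁻ B u∈
      ... | inj₁ u∈B  = B⊆U′ u∈B
      ... | inj₂ refl = b∈U′

      -- A part of `U″` avoiding `b` lies in `B`, and it is also separated in `U′`, because
      -- neighbours of `B` in `U′` stay in `U″`. Were it smaller than `B`, the minimality of `B`
      -- would fail.
      tight″ : Tight U″ b
      tight″ {B₁} {b₁} (sep ne₁ B₁⊆U″ b₁∈U″ b₁∉B₁ closed₁) b∉B₁ {u} u∈ =
        decidable-stable (u ∈? B₁) λ u∉B₁ →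
          minimal (B₁⊆B , u , u∈B , u∉B₁)
            ((b₁ , sep ne₁ (B⊆U′ ∘ B₁⊆B) (U″⊆U′ b₁∈U″) b₁∉B₁
               λ v∈ w∈ v~w → closed₁ v∈ (x∈p∪⁅y⁆⁺ (closed (B₁⊆B v∈) w∈ v~w)) v~w)
            , y∉B ∘ B₁⊆B)
        where
        B₁⊆B : B₁ ⊆ B
        B₁⊆B v∈ with x∈p∪⁅y⁆⁻ B (B₁⊆U″ v∈)
        ... | inj₁ v∈B  = v∈B
        ... | inj₂ refl = contradiction v∈ b∉B₁
        u∈B : u ∈ B
        u∈B with x∈p∪⁅y⁆⁻ B (x∈p-y⇒x∈p u∈)
        ... | inj₁ u∈B = u∈B
        ... | inj₂ u≡b = contradiction u≡b (x∈p-y⇒x≢y u∈)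

      -- Among its neighbours in `U`, a vertex of `B` can lose only `x`.
      mindeg″ : MinDegreeOff U″ b (suc d)
      mindeg″ {u} u∈ u≢b with x∈p∪⁅y⁆⁻ B u∈
      ... | inj₂ u≡b = contradiction u≡b u≢b
      ... | inj₁ u∈B = ≤-pred (≤-trans (mindeg (x∈p-y⇒x∈p (B⊆U′ u∈B)) λ { refl → y∉B u∈B })
        (≤-trans (deg-remove U u x) (s≤s (count-mono (adjacentIn? U′ u) (adjacentIn? U″ u)
          λ (w∈ , u~w) → x∈p∪⁅y⁆⁺ (closed u∈B w∈ u~w) , u~w))))

      x∉B : x ∉ B
      x∉B x∈B = x∈p-y⇒x≢y (B⊆U′ x∈B) refl

      not-separated-by : ∀ {B₁ b₁} → Sep U B₁ b₁ → y ∉ B₁ → x ∈ B₁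
      not-separated-by s y∉ = tight s y∉ (x∈p∧x≢y⇒x∈p-y x∈U x≢y)

      x-adjacent-B : ∃[ x′ ] (x′ ∈ B × x ~ x′)
      x-adjacent-B with FinP.any? (λ u → adjacentIn? B x u)
      ... | yes found = found
      -- Otherwise `b` separates `B` from `y` in all of `U`, and tightness would put `x` into `B`.
      ... | no none = contradiction (not-separated-by sepU y∉B) x∉B
        where
        closedU : ∀ {u w} → u ∈ B → w ∈ U → u ~ w → w ∈ B ⊎ w ≡ b
        closedU {u} {w} u∈B w∈U u~w with w ≟ x
        ... | yes refl = contradiction (u , u∈B , ~-sym u~w) none
        ... | no w≢x   = closed u∈B (x∈p∧x≢y⇒x∈p-y w∈U w≢x) u~w
        sepU : Sep U B b
        sepU = sep ne (x∈p-y⇒x∈p ∘ B⊆U′) (x∈p-y⇒x∈p b∈U′) b∉B closedU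

      W = U′ ─ B

      b-reaches-y : Reachable W b y
      b-reaches-y with reachable? W b y
      ... | yes found = found
      -- Otherwise `x` separates from `y` the set `B` together with the component of `b` outside
      -- `B`, and tightness would put `x` into that set.
      ... | no unreachable = contradiction (not-separated-by sepU y∉D∪B) x∉D∪B
        where
        D = component W b
        D⊆W : D ⊆ W
        D⊆W = target∈ ∘ proj₂ ∘ ∈⟦⟧⁻ (reachable? W b)
        D⊆U′ : D ⊆ U′
        D⊆U′ = p─q⊆p U′ B ∘ D⊆W
        b∈D : b ∈ D
        b∈D = ∈⟦⟧⁺ (reachable? W b) (_ , [ x∈p∧x∉q⇒x∈p─q b∈U′ b∉B ])
        D∪B⊆U′ : D ∪ B ⊆ U′
        D∪B⊆U′ = [ D⊆U′ , B⊆U′ ]′ ∘ x∈p∪q⁻ D B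
        x∉D∪B : x ∉ D ∪ B
        x∉D∪B x∈ = x∈p-y⇒x≢y (D∪B⊆U′ x∈) refl
        y∉D∪B : y ∉ D ∪ B
        y∉D∪B = [ unreachable ∘ ∈⟦⟧⁻ (reachable? W b) , y∉B ]′ ∘ x∈p∪q⁻ D B
        closedU : ∀ {u w} → u ∈ D ∪ B → w ∈ U → u ~ w → w ∈ D ∪ B ⊎ w ≡ x
        closedU {u} {w} u∈ w∈U u~w with w ≟ x
        ... | yes w≡x = inj₂ w≡x
        ... | no w≢x = inj₁ (x∈p∪q⁺ (go (w ∈? B) (x∈p∪q⁻ D B u∈)))
          where
          w∈U′ = x∈p∧x≢y⇒x∈p-y w∈U w≢x
          go : Dec (w ∈ B) → u ∈ D ⊎ u ∈ B → w ∈ D ⊎ w ∈ B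
          go (yes w∈B) _          = inj₂ w∈B
          go (no w∉B) (inj₁ u∈D) = inj₁ (component-closed W b u∈D u~w (x∈p∧x∉q⇒x∈p─q w∈U′ w∉B))
          go (no w∉B) (inj₂ u∈B) with closed u∈B w∈U′ u~w
          ... | inj₁ w∈B  = inj₂ w∈B
          ... | inj₂ refl = inj₁ b∈D
        sepU : Sep U (D ∪ B) x
        sepU = sep (b , x∈p∪q⁺ (inj₁ b∈D)) (x∈p-y⇒x∈p ∘ D∪B⊆U′) x∈U x∉D∪B closedU

      result : Path≥ U x y (suc (suc d))
      result with x-adjacent-B | b-reaches-y
      ... | x′ , x′∈B , x~x′ | m′ , q
        with long-path d {x = x′} tight″ (x∈p∪⁅y⁆⁺ (inj₂ refl)) mindeg″ (x∈p∪⁅y⁆⁺ (inj₁ x′∈B))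
               (λ { refl → b∉B x′∈B })
      ... | m , d<m , p = _ , s≤s (≤-trans d<m (m≤m+n m m′)) ,
        x∈U ~⟨ x~x′ ⟩ path-⊆ ([ U″⊆U′ , p─q⊆p U′ B ]′ ∘ x∈p∪q⁻ U″ W) (path-++ meet p q)
        where
        meet : ∀ {u} → u ∈ U″ → u ∈ W → u ≡ b
        meet u∈ u∈W with x∈p∪⁅y⁆⁻ B u∈
        ... | inj₁ u∈B = contradiction u∈B (x∈p─q⇒x∉q u∈W)
        ... | inj₂ u≡b = u≡b

-- The number of edges of a keyring.

injective-∈⇒≤length : ∀ {m} (f : Fin m → A) → Injective _≡_ _≡_ f →
                      {xs : List A} → (∀ i → f i ∈ˡ xs) → m ≤ length xs
injective-∈⇒≤length f f-inj {xs} f∈ = FinP.injective⇒≤ {f = index ∘ f∈} λ {i} {j} eq →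
  f-inj (trans (lookup-index (f∈ i))
    (trans (cong (List.lookup xs) eq) (sym (lookup-index (f∈ j)))))

∈-edges : (G : Graph n) → let open Graph G in ∀ {u v} → u Fin.< v → u ~ v → (u , v) ∈ˡ edges G
∈-edges G u<v u~v =
  ∈-filter⁺ (λ (u , v) → (u Fin.<? v) ×-dec (u ~? v))
    (∈-cartesianProduct⁺ (∈-allFin _) (∈-allFin _)) (u<v , u~v)
  where open Graph G

splitAt-injective : ∀ m {n} {i j : Fin (m + n)} → splitAt m i ≡ splitAt m j → i ≡ j
splitAt-injective m {n} {i} {j} eq =
  trans (sym (FinP.join-splitAt m n i)) (trans (cong (join m n) eq) (FinP.join-splitAt m n j))

module _ (c r : ℕ) where
  private
    C : ℕ
    C = suc (suc (suc c))
    3≤C : 3 ≤ C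
    3≤C = s≤s (s≤s (s≤s z≤n))
    K : Graph (C + r)
    K = keyring 3≤C zero r
    V : Set
    V = Fin (C + r)

    -- The two ends, in increasing order, of an edge assigned to each vertex: the closing edge to 0,
    -- the edge from its predecessor to any other cycle vertex, and its only edge to a leaf. This
    -- injection gives at least `C + r` edges.
    lower upper : Fin C ⊎ Fin r → Fin C ⊎ Fin r
    lower (inj₁ zero)    = inj₁ zero
    lower (inj₁ (suc i)) = inj₁ (inject₁ i)
    lower (inj₂ _)       = inj₁ zero
    upper (inj₁ zero)    = inj₁ (fromℕ _)
    upper (inj₁ (suc i)) = inj₁ (suc i)
    upper (inj₂ j)       = inj₂ j

    ends-injective : ∀ a b → lower a ≡ lower b → upper a ≡ upper b → a ≡ b
    ends-injective (inj₁ zero)    (inj₁ zero)          _  _  = refl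
    -- The closing edge and the edge from 0 to 1 share the lower end; their upper ends differ
    -- because the cycle has at least three vertices.
    ends-injective (inj₁ zero)    (inj₁ (suc zero))    _  ()
    ends-injective (inj₁ zero)    (inj₁ (suc (suc i))) ()
    ends-injective (inj₁ (suc zero))    (inj₁ zero)    _  ()
    ends-injective (inj₁ (suc (suc i))) (inj₁ zero)    ()
    ends-injective (inj₁ (suc i)) (inj₁ (suc j))       _  eq = eq
    ends-injective (inj₂ _)       (inj₁ zero)          _  ()
    ends-injective (inj₂ _)       (inj₁ (suc _))       _  ()
    ends-injective (inj₂ i)       (inj₂ j)             _  eq = eq

    adjacent : ∀ a → LeafAdj (cycle 3≤C) zero r (lower a) (upper a)
    adjacent (inj₁ zero)    = inj₂ (inj₂ (cong suc (FinP.toℕ-fromℕ _) , refl))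
    adjacent (inj₁ (suc i)) = inj₁ (inj₁ (cong suc (sym (FinP.toℕ-inject₁ i))))
    adjacent (inj₂ j)       = refl

    toℕ-join : Fin C ⊎ Fin r → ℕ
    toℕ-join = [ toℕ , (λ j → C + toℕ j) ]′

    toℕ-join≡ : ∀ a → toℕ (join C r a) ≡ toℕ-join a
    toℕ-join≡ (inj₁ i) = FinP.toℕ-↑ˡ i r
    toℕ-join≡ (inj₂ j) = FinP.toℕ-↑ʳ C j

    lower<upper : ∀ a → toℕ-join (lower a) < toℕ-join (upper a)
    lower<upper (inj₁ zero)    = s≤s z≤n
    lower<upper (inj₁ (suc i)) = s≤s (≤-reflexive (FinP.toℕ-inject₁ i))
    lower<upper (inj₂ j)       = s≤s z≤n

    edge : V → V × V
    edge x = join C r (lower (splitAt C x)) , join C r (upper (splitAt C x))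

    join-injective : ∀ {a b} → join C r a ≡ join C r b → a ≡ b
    join-injective {a} {b} eq =
      trans (sym (FinP.splitAt-join C r a)) (trans (cong (splitAt C) eq) (FinP.splitAt-join C r b))

    edge-injective : Injective _≡_ _≡_ edge
    edge-injective {x} {y} eq = splitAt-injective C
      (ends-injective (splitAt C x) (splitAt C y)
        (join-injective (proj₁ (,-injective eq))) (join-injective (proj₂ (,-injective eq))))

    edge∈ : ∀ x → edge x ∈ˡ edges K
    edge∈ x = ∈-edges K
      (subst₂ _<_ (sym (toℕ-join≡ (lower a))) (sym (toℕ-join≡ (upper a))) (lower<upper a))
      (subst₂ (LeafAdj (cycle 3≤C) zero r)
        (sym (FinP.splitAt-join C r (lower a))) (sym (FinP.splitAt-join C r (upper a))) (adjacent a))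
      where a = splitAt C x

  keyring-edges : C + r ≤ e K
  keyring-edges = injective-∈⇒≤length edge edge-injective edge∈

-- Vertices of a path, truncation, and embedding a keyring.

module _ (G : Graph n) where
  open Graph G

  vertex : ∀ {U x z m} → Path G U x z m → Fin (suc m) → Fin n
  vertex {x = x} [ _ ]          _       = x
  vertex {x = x} (_ ~⟨ _ ⟩ _) zero    = x
  vertex         (_ ~⟨ _ ⟩ p) (suc i) = vertex p i

  vertex-∈ : ∀ {U x z m} (p : Path G U x z m) i → vertex p i ∈ U
  vertex-∈ [ x∈U ]           _       = x∈U
  vertex-∈ (x∈U ~⟨ _ ⟩ _) zero    = x∈U
  vertex-∈ (_   ~⟨ _ ⟩ p) (suc i) = x∈p-y⇒x∈p (vertex-∈ p i)

  vertex-injective : ∀ {U x z m} (p : Path G U x z m) → Injective _≡_ _≡_ (vertex p)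
  vertex-injective [ _ ]         {zero}  {zero}  _  = refl
  vertex-injective (_ ~⟨ _ ⟩ p) {zero}  {zero}  _  = refl
  vertex-injective (_ ~⟨ _ ⟩ p) {zero}  {suc j} eq = contradiction (sym eq) (x∈p-y⇒x≢y (vertex-∈ p j))
  vertex-injective (_ ~⟨ _ ⟩ p) {suc i} {zero}  eq = contradiction eq (x∈p-y⇒x≢y (vertex-∈ p i))
  vertex-injective (_ ~⟨ _ ⟩ p) {suc i} {suc j} eq = cong suc (vertex-injective p eq)

  vertex-zero : ∀ {U x z m} (p : Path G U x z m) → vertex p zero ≡ x
  vertex-zero [ _ ]         = refl
  vertex-zero (_ ~⟨ _ ⟩ _) = refl

  vertex-last : ∀ {U x z m} (p : Path G U x z m) i → toℕ i ≡ m → vertex p i ≡ z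
  vertex-last [ _ ]         _       _  = refl
  vertex-last (_ ~⟨ _ ⟩ p) (suc i) eq = vertex-last p i (suc-injective eq)

  vertex-step : ∀ {U x z m} (p : Path G U x z m) i j → toℕ j ≡ suc (toℕ i) → vertex p i ~ vertex p j
  vertex-step [ _ ] zero zero ()
  vertex-step (_ ~⟨ x~y ⟩ p) zero    (suc zero) _  = subst (_ ~_) (sym (vertex-zero p)) x~y
  vertex-step (_ ~⟨ x~y ⟩ p) (suc i) (suc j)    eq = vertex-step p i j (suc-injective eq)

  OnPath : ∀ {U x z m} → Path G U x z m → Fin n → Set
  OnPath p w = ∃[ i ] vertex p i ≡ w

  onPath? : ∀ {U x z m} (p : Path G U x z m) → Decidable (OnPath p)
  onPath? p w = FinP.any? λ i → vertex p i ≟ w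

  module _ {Q : Pred (Fin n) 0ℓ} (Q? : Decidable Q) where

    hits? : ∀ {U x z m} (p : Path G U x z m) → Decidable (λ w → Q w × OnPath p w)
    hits? p w = Q? w ×-dec onPath? p w

    hits : ∀ {U x z m} → Path G U x z m → ℕ
    hits p = count (hits? p)

    hits-[] : ∀ {U x} (x∈U : x ∈ U) → hits [ x∈U ] ≤ 1
    hits-[] {x = x} x∈U = count-unique (hits? [ x∈U ]) x λ (_ , _ , eq) → sym eq

    module _ {U x y z m} (x∈U : x ∈ U) (x~y : x ~ y) (p : Path G (U - x) y z m) where

      onPath-cons : ∀ {w} → Q w × OnPath (x∈U ~⟨ x~y ⟩ p) w → (Q w × w ≡ x) ⊎ (Q w × OnPath p w)
      onPath-cons (q , zero  , eq) = inj₁ (q , sym eq)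
      onPath-cons (q , suc i , eq) = inj₂ (q , i , eq)

      hits-cons : hits (x∈U ~⟨ x~y ⟩ p) ≤ suc (hits p)
      hits-cons = ≤-trans
        (count-⊎ (hits? (x∈U ~⟨ x~y ⟩ p)) (λ w → Q? w ×-dec (w ≟ x)) (hits? p) onPath-cons)
        (+-mono-≤ (count-unique (λ w → Q? w ×-dec (w ≟ x)) x proj₂) ≤-refl)

      hits-cons-¬ : ¬ Q x → hits (x∈U ~⟨ x~y ⟩ p) ≤ hits p
      hits-cons-¬ ¬q = count-mono (hits? (x∈U ~⟨ x~y ⟩ p)) (hits? p) λ h →
        [ (λ { (q , refl) → contradiction q ¬q }) , id ]′ (onPath-cons h)

    -- The bound on hits counts the first t vertices and the last one.
    truncate : ∀ {U x z m} t → Path G U x z m → t ≤ m → Q z →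
               ∃[ z′ ] ∃[ m′ ] Σ[ p ∈ Path G U x z′ m′ ] (t ≤ m′ × Q z′ × hits p ≤ suc t)
    truncate zero [ x∈U ] _ Qz = _ , _ , [ x∈U ] , z≤n , Qz , hits-[] x∈U
    -- The required steps are done: the path stops at the first vertex satisfying `Q`, and vertices
    -- passed over before it add nothing to the count.
    truncate {x = x} zero (x∈U ~⟨ x~y ⟩ p) _ Qz with Q? x
    ... | yes q = _ , _ , [ x∈U ] , z≤n , q , hits-[] x∈U
    ... | no ¬q with truncate zero p z≤n Qz
    ... | _ , _ , p′ , _ , Qz′ , h =
      _ , _ , x∈U ~⟨ x~y ⟩ p′ , z≤n , Qz′ , ≤-trans (hits-cons-¬ x∈U x~y p′ ¬q) h
    truncate (suc t) (x∈U ~⟨ x~y ⟩ p) (s≤s t≤m) Qz with truncate t p t≤m Qz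
    ... | _ , _ , p′ , t≤m′ , Qz′ , h =
      _ , _ , x∈U ~⟨ x~y ⟩ p′ , s≤s t≤m′ , Qz′ , ≤-trans (hits-cons x∈U x~y p′) (s≤s h)

  -- The edge from `z` back to `x` closes the path to a cycle on `m + 1` vertices; position 0, which
  -- carries the leaves, is `x`.
  keyring-⊑ : ∀ {U x z m r} (2≤m : 2 ≤ m) (p : Path G U x z m) → z ~ x →
              (g : Fin r → Fin n) → Injective _≡_ _≡_ g → (∀ i → x ~ g i) → (∀ i → ¬ OnPath p (g i)) →
              keyring (s≤s 2≤m) zero r ⊑ G
  keyring-⊑ {x = x} {m = m} {r} 2≤m p z~x g g-inj x~g g∉p = record
    { embed     = place ∘ splitAt (suc m)
    ; injective = splitAt-injective (suc m) ∘ place-injective _ _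
    ; preserves = λ {u} {v} → place-preserves (splitAt (suc m) u) (splitAt (suc m) v)
    }
    where
    place : Fin (suc m) ⊎ Fin r → Fin n
    place = [ vertex p , g ]′

    place-injective : ∀ a b → place a ≡ place b → a ≡ b
    place-injective (inj₁ i) (inj₁ j) eq = cong inj₁ (vertex-injective p eq)
    place-injective (inj₁ i) (inj₂ j) eq = contradiction (i , eq) (g∉p j)
    place-injective (inj₂ i) (inj₁ j) eq = contradiction (j , sym eq) (g∉p i)
    place-injective (inj₂ i) (inj₂ j) eq = cong inj₂ (g-inj eq)

    next-adjacent : ∀ i j → Next (suc m) i j → vertex p i ~ vertex p j
    next-adjacent i j (inj₁ eq) = vertex-step p i j eq
    next-adjacent i zero (inj₂ (last , _)) =
      subst₂ _~_ (sym (vertex-last p i (suc-injective last))) (sym (vertex-zero p)) z~x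

    place-preserves : ∀ a b → LeafAdj (cycle (s≤s 2≤m)) zero r a b → place a ~ place b
    place-preserves (inj₁ i) (inj₁ j) (inj₁ next) = next-adjacent i j next
    place-preserves (inj₁ i) (inj₁ j) (inj₂ next) = ~-sym (next-adjacent j i next)
    place-preserves (inj₁ _) (inj₂ j) refl = subst (_~ g j) (sym (vertex-zero p)) (x~g j)
    place-preserves (inj₂ i) (inj₁ _) refl = ~-sym (subst (_~ g i) (sym (vertex-zero p)) (x~g i))

  -- Degree sums and minimal dense sets.

  size : Subset n → ℕ
  size U = count (_∈? U)

  -- The condition on `u` stands apart so that `count-×` bounds each row of the degree sum by an
  -- indicator times a degree.
  edge? : ∀ U u → Decidable (λ v → u ∈ U × (v ∈ U × u ~ v))
  edge? U u v = (u ∈? U) ×-dec adjacentIn? G U u v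

  -- Twice the number of edges induced on `U`, counted as ordered pairs.
  degreeSum : Subset n → ℕ
  degreeSum U = sum λ u → count (edge? U u)

  -- Each listed edge contributes both of its orientations, and these are distinct pairs since `<`
  -- is asymmetric.
  e≤degreeSum : 2 * e G ≤ degreeSum ⊤
  e≤degreeSum = begin
    2 * e G                       ≡⟨ cong (e G +_) (+-identityʳ (e G)) ⟩
    e G + e G                     ≡⟨ cong₂ _+_ e≡ (trans e≡ (∑-comm λ u v → 𝟙 (up? u v))) ⟩
    sum (λ u → count (up? u)) + sum (λ u → count (λ v → up? v u))
      ≤⟨ sum-+-≤ _ _ _ (λ u → count-disjoint (up? u) (λ v → up? v u) (edge? ⊤ u)
           (λ (u<v , _) (v<u , _) → FinP.<-asym u<v v<u)
           (λ (_ , u~v) → ∈⊤ , ∈⊤ , u~v)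
           (λ (_ , v~u) → ∈⊤ , ∈⊤ , ~-sym v~u)) ⟩
    degreeSum ⊤ ∎
    where
    open ≤-Reasoning
    up? : ∀ u → Decidable (λ v → u Fin.< v × u ~ v)
    up? u v = (u Fin.<? v) ×-dec (u ~? v)
    e≡ : e G ≡ sum (λ u → count (up? u))
    e≡ = length-filter-cartesianProduct (λ (u , v) → up? u v) id id

  degreeSum≤ : ∀ U q → (∀ {u} → u ∈ U → deg G U u ≤ q) → degreeSum U ≤ size U * q
  degreeSum≤ U q deg≤ = ≤-trans (sum-mono _ (λ u → 𝟙 (u ∈? U) * q) row)
                                (≤-reflexive (sum-const-* (λ u → 𝟙 (u ∈? U)) q))
    where
    row : ∀ u → count (edge? U u) ≤ 𝟙 (u ∈? U) * q
    row u with u ∈? U | count-× (u ∈? U) (adjacentIn? G U u)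
    ... | yes u∈U | le = ≤-trans le (*-monoʳ-≤ 1 (deg≤ u∈U))
    ... | no  _   | le = le

  size-remove : ∀ {U u} → u ∈ U → suc (size (U - u)) ≤ size U
  size-remove {U} {u} u∈U = ≤-trans
    (+-mono-≤ (count-≥1 (_≟ u) u refl) ≤-refl)
    (count-disjoint (_≟ u) (_∈? (U - u)) (_∈? U)
      (λ { refl w∈ → x∈p-y⇒x≢y w∈ refl }) (λ { refl → u∈U }) x∈p-y⇒x∈p)

  deg≤size : ∀ U u → deg G U u ≤ size (U - u)
  deg≤size U u = count-mono (adjacentIn? G U u) (_∈? (U - u))
    λ (w∈U , u~w) → x∈p∧x≢y⇒x∈p-y w∈U λ w≡u → ~-irrefl (sym w≡u) u~w

  -- An ordered adjacent pair either avoids `u` or has `u` as its first or as its second entry; each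
  -- of the last two kinds is counted by the degree of `u`.
  degreeSum-remove : ∀ U u → degreeSum U ≤ degreeSum (U - u) + 2 * deg G U u
  degreeSum-remove U u = begin
    degreeSum U
      ≤⟨ sum-≤-+ _ _ _ (λ a → sum-≤-+ _ _ _ λ c →
           𝟙-⊎ (edge? U a c) (edge? (U - u) a c) (touch? a c) cases) ⟩
    degreeSum (U - u) + sum (λ a → count (touch? a))
      ≤⟨ +-monoʳ-≤ (degreeSum (U - u)) (sum-≤-+ _ _ _ λ a → sum-≤-+ _ _ _ λ c →
           𝟙-⊎ (touch? a c) (at? a c) (at? c a) id) ⟩
    degreeSum (U - u) + (sum (λ a → count (at? a)) + sum (λ a → count (λ c → at? c a)))
      ≡⟨ cong (λ t → degreeSum (U - u) + (sum (λ a → count (at? a)) + t))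
           (∑-comm (λ a c → 𝟙 (at? c a))) ⟩
    degreeSum (U - u) + (sum (λ a → count (at? a)) + sum (λ a → count (at? a)))
      ≤⟨ +-monoʳ-≤ (degreeSum (U - u)) (+-mono-≤ at≤ at≤) ⟩
    degreeSum (U - u) + (deg G U u + deg G U u)
      ≡⟨ cong (λ t → degreeSum (U - u) + (deg G U u + t)) (+-identityʳ _) ⟨
    degreeSum (U - u) + 2 * deg G U u ∎
    where
    open ≤-Reasoning
    at? : ∀ a → Decidable (λ c → a ≡ u × (c ∈ U × u ~ c))
    at? a c = (a ≟ u) ×-dec adjacentIn? G U u c
    touch? : ∀ a c → Dec _
    touch? a c = at? a c ⊎-dec at? c a
    at≤ : sum (λ a → count (at? a)) ≤ deg G U u
    at≤ = begin
      sum (λ a → count (at? a))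
        ≤⟨ sum-mono _ (λ a → 𝟙 (a ≟ u) * deg G U u) (λ a → count-× (a ≟ u) (adjacentIn? G U u)) ⟩
      sum (λ a → 𝟙 (a ≟ u) * deg G U u) ≡⟨ sum-const-* (λ a → 𝟙 (a ≟ u)) (deg G U u) ⟩
      count (_≟ u) * deg G U u ≤⟨ *-monoˡ-≤ (deg G U u) (count-unique (_≟ u) u id) ⟩
      1 * deg G U u ≡⟨ *-identityˡ _ ⟩
      deg G U u ∎
    cases : ∀ {a c} → a ∈ U × (c ∈ U × a ~ c) →
            (a ∈ U - u × (c ∈ U - u × a ~ c)) ⊎
            ((a ≡ u × (c ∈ U × u ~ c)) ⊎ (c ≡ u × (a ∈ U × u ~ a)))
    cases {a} {c} (a∈ , c∈ , a~c) with a ≟ u | c ≟ u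
    ... | yes refl | _        = inj₂ (inj₁ (refl , c∈ , a~c))
    ... | no _     | yes refl = inj₂ (inj₂ (refl , a∈ , ~-sym a~c))
    ... | no a≢u   | no c≢u   = inj₁ (x∈p∧x≢y⇒x∈p-y a∈ a≢u , x∈p∧x≢y⇒x∈p-y c∈ c≢u , a~c)

  module _ {U B b} (s : Sep G U B b) where
    open Sep s

    -- An edge with an end in `B` stays within `B ∪ ⁅ b ⁆`; every other edge avoids `B`.
    degreeSum-split : degreeSum U ≤ degreeSum (B ∪ ⁅ b ⁆) + degreeSum (U ─ B)
    degreeSum-split = sum-≤-+ _ _ _ λ a → sum-≤-+ _ _ _ λ c →
      𝟙-⊎ (edge? U a c) (edge? (B ∪ ⁅ b ⁆) a c) (edge? (U ─ B) a c) cases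
      where
      cases : ∀ {a c} → a ∈ U × (c ∈ U × a ~ c) →
              (a ∈ B ∪ ⁅ b ⁆ × (c ∈ B ∪ ⁅ b ⁆ × a ~ c)) ⊎ (a ∈ U ─ B × (c ∈ U ─ B × a ~ c))
      cases {a} {c} (a∈ , c∈ , a~c) with a ∈? B | c ∈? B
      ... | yes a∈B | _       = inj₁ (x∈p∪⁅y⁆⁺ (inj₁ a∈B) , x∈p∪⁅y⁆⁺ (closed a∈B c∈ a~c) , a~c)
      ... | no _    | yes c∈B = inj₁ (x∈p∪⁅y⁆⁺ (closed c∈B a∈ (~-sym a~c)) , x∈p∪⁅y⁆⁺ (inj₁ c∈B) , a~c)
      ... | no a∉B  | no c∉B  = inj₂ (x∈p∧x∉q⇒x∈p─q a∈ a∉B , x∈p∧x∉q⇒x∈p─q c∈ c∉B , a~c)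

    -- The parts share the vertex `b`, hence the extra one.
    size-split : size (B ∪ ⁅ b ⁆) + size (U ─ B) ≤ suc (size U)
    size-split = begin
      size (B ∪ ⁅ b ⁆) + size (U ─ B)
        ≤⟨ +-monoˡ-≤ (size (U ─ B)) (count-⊎ (_∈? (B ∪ ⁅ b ⁆)) (_≟ b) (_∈? B)
             λ w∈ → [ inj₂ , inj₁ ]′ (x∈p∪⁅y⁆⁻ B w∈)) ⟩
      count (_≟ b) + size B + size (U ─ B)
        ≤⟨ +-monoˡ-≤ (size (U ─ B)) (+-monoˡ-≤ (size B) (count-unique (_≟ b) b id)) ⟩
      suc (size B + size (U ─ B))
        ≤⟨ s≤s (count-disjoint (_∈? B) (_∈? (U ─ B)) (_∈? U)
             (λ w∈B w∈ → x∈p─q⇒x∉q w∈ w∈B) B⊆U (p─q⊆p U B)) ⟩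
      suc (size U) ∎
      where open ≤-Reasoning

  -- The threshold uses the size minus one so that it adds up over two parts sharing one vertex;
  -- this is what makes minimal dense sets 2-connected.
  Dense : ℕ → Subset n → Set
  Dense K U = K * (size U ∸ 1) < degreeSum U

  dense? : ∀ K → Decidable (Dense K)
  dense? K U = suc (K * (size U ∸ 1)) ≤? degreeSum U

  module _ {K : ℕ} {U : Subset n} (min : Minimal (Dense K) U) where
    private
      dense = proj₁ min

      sparse : ∀ {T} → T ⊂ U → degreeSum T ≤ K * (size T ∸ 1)
      sparse T⊂U = ≮⇒≥ (proj₂ min T⊂U)

    -- If `B` missed a vertex other than `y`, then `B ∪ ⁅ b ⁆` and `U ─ B` would both be proper
    -- subsets, hence not dense, and their bounds would add up to contradict the density of `U`.
    minimal-dense⇒tight : ∀ {y} → y ∈ U → Tight G U y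
    minimal-dense⇒tight {y} y∈U {B} {b} s y∉B {x} x∈ = decidable-stable (x ∈? B) λ x∉B →
      <⇒≱ dense (bound (separate x∉B))
      where
      open Sep s
      T = B ∪ ⁅ b ⁆
      T⊆U : T ⊆ U
      T⊆U w∈ with x∈p∪⁅y⁆⁻ B w∈
      ... | inj₁ w∈B  = B⊆U w∈B
      ... | inj₂ refl = b∈U
      separate : x ∉ B → T ⊂ U
      separate x∉B with x ≟ b
      ... | no x≢b   = T⊆U , x , x∈p-y⇒x∈p x∈ , [ x∉B , x≢b ]′ ∘ x∈p∪⁅y⁆⁻ B
      -- If the missed vertex is `b` itself, then `y` witnesses that `T` is proper.
      ... | yes refl = T⊆U , y , y∈U , [ y∉B , x∈p-y⇒x≢y x∈ ∘ sym ]′ ∘ x∈p∪⁅y⁆⁻ B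
      U─B⊂U : U ─ B ⊂ U
      U─B⊂U = p─q⊆p U B , _ , B⊆U (proj₂ nonempty) , λ w∈ → x∈p─q⇒x∉q w∈ (proj₂ nonempty)
      -- Truncated subtraction requires both parts to be nonempty; both contain `b`.
      sizes : ∀ i j l → 1 ≤ i → 1 ≤ j → i + j ≤ suc l → (i ∸ 1) + (j ∸ 1) ≤ l ∸ 1
      sizes (suc i) (suc j) l _ _ le =
        ∸-monoˡ-≤ 1 (≤-trans (≤-reflexive (sym (+-suc i j))) (≤-pred le))
      bound : T ⊂ U → degreeSum U ≤ K * (size U ∸ 1)
      bound T⊂U = begin
        degreeSum U                               ≤⟨ degreeSum-split s ⟩
        degreeSum T + degreeSum (U ─ B)           ≤⟨ +-mono-≤ (sparse T⊂U) (sparse U─B⊂U) ⟩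
        K * (size T ∸ 1) + K * (size (U ─ B) ∸ 1) ≡⟨ *-distribˡ-+ K _ _ ⟨
        K * ((size T ∸ 1) + (size (U ─ B) ∸ 1))
          ≤⟨ *-monoʳ-≤ K (sizes _ _ (size U)
               (count-≥1 (_∈? T) b (x∈p∪⁅y⁆⁺ (inj₂ refl)))
               (count-≥1 (_∈? (U ─ B)) b (x∈p∧x∉q⇒x∈p─q b∈U b∉B)) (size-split s)) ⟩
        K * (size U ∸ 1) ∎
        where open ≤-Reasoning

    -- Deleting a vertex of degree at most `K / 2` lowers the degree sum by at most `K`, which the
    -- smaller threshold absorbs, so a smaller dense set would remain.
    minimal-dense⇒min-degree : ∀ {u} → u ∈ U → K < 2 * deg G U u
    minimal-dense⇒min-degree {u} u∈U = ≰⇒> λ 2deg≤K → <⇒≱ dense (begin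
      degreeSum U                                    ≤⟨ degreeSum-remove U u ⟩
      degreeSum (U - u) + 2 * deg G U u              ≤⟨ +-monoˡ-≤ _ (sparse (x∈p⇒p-x⊂p u∈U)) ⟩
      K * (size (U - u) ∸ 1) + 2 * deg G U u         ≤⟨ absorb _ _ (deg≤size U u) 2deg≤K ⟩
      K * size (U - u)                               ≤⟨ *-monoʳ-≤ K (∸-monoˡ-≤ 1 (size-remove u∈U)) ⟩
      K * (size U ∸ 1)                               ∎)
      where
      open ≤-Reasoning
      absorb : ∀ t d → d ≤ t → 2 * d ≤ K → K * (t ∸ 1) + 2 * d ≤ K * t
      -- If nothing is left beside `u`, truncation keeps the threshold from dropping, but then `u`
      -- has degree 0.
      absorb zero    .zero z≤n _ = ≤-reflexive (+-identityʳ _)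
      absorb (suc t) d _ 2d≤K = begin
        K * t + 2 * d ≤⟨ +-monoʳ-≤ (K * t) 2d≤K ⟩
        K * t + K     ≡⟨ +-comm (K * t) K ⟩
        K + K * t     ≡⟨ *-suc K t ⟨
        K * suc t     ∎

  -- Otherwise every degree is at most `K`, and always at most the size minus one. The second bound
  -- refutes density when the size is at most `K + 1`, the first when it is larger.
  minimal-dense⇒max-degree : ∀ {K U} → Dense (suc K) U → ∃[ v ] (v ∈ U × suc K ≤ deg G U v)
  minimal-dense⇒max-degree {K} {U} dense with FinP.any? (λ v → (v ∈? U) ×-dec (suc K ≤? deg G U v))
  ... | yes found = found
  ... | no none = contradiction (bound (size U) refl) (<⇒≱ dense)
    where
    open ≤-Reasoning
    deg≤K : ∀ {u} → u ∈ U → deg G U u ≤ K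
    deg≤K u∈U = ≤-pred (≰⇒> λ K<deg → none (_ , u∈U , K<deg))
    deg≤size-1 : ∀ {u} → u ∈ U → deg G U u ≤ size U ∸ 1
    deg≤size-1 {u} u∈U = ≤-trans (deg≤size U u) (∸-monoˡ-≤ 1 (size-remove u∈U))
    bound : ∀ l → size U ≡ l → degreeSum U ≤ suc K * (size U ∸ 1)
    bound l eq with size U ≤? suc K
    ... | yes le = ≤-trans (degreeSum≤ U (size U ∸ 1) deg≤size-1) (*-monoˡ-≤ (size U ∸ 1) le)
    bound zero eq | no gt = contradiction (≤-trans (≤-reflexive eq) z≤n) gt
    bound (suc l) eq | no gt = begin
      degreeSum U          ≤⟨ degreeSum≤ U K deg≤K ⟩
      size U * K           ≡⟨ cong (_* K) eq ⟩
      K + l * K            ≤⟨ +-mono-≤ (≤-pred (≤-trans (n≤1+n _) (subst (suc (suc K) ≤_) eq (≰⇒> gt))))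
                                         (≤-reflexive (*-comm l K)) ⟩
      l + K * l            ≡⟨⟩
      suc K * l            ≡⟨ cong (λ t → suc K * (t ∸ 1)) eq ⟨
      suc K * (size U ∸ 1) ∎

  -- Assembling the keyring.

  offPath? : ∀ v {U x z m} (p : Path G U x z m) → Decidable (λ w → v ~ w × ¬ OnPath p w)
  offPath? v p w = (v ~? w) ×-dec ¬? (onPath? p w)

  deg≤offPath+hits : ∀ T v {U x z m} (p : Path G U x z m) →
                     deg G T v ≤ count (offPath? v p) + hits (v ~?_) p
  deg≤offPath+hits T v p = count-⊎ (adjacentIn? G T v) (offPath? v p) (hits? (v ~?_) p) split
    where
    split : ∀ {w} → w ∈ T × v ~ w → (v ~ w × ¬ OnPath p w) ⊎ (v ~ w × OnPath p w)
    split {w} (_ , v~w) with onPath? p w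
    ... | yes on = inj₂ (v~w , on)
    ... | no off = inj₁ (v~w , off)

  -- Here `k` is `3 + (r + s)`, so that `3 + s` is `k − r`, the least cycle length that suffices.
  path⇒keyring : ∀ {U v y m} r s → 2 + (r + s) ≤ deg G U v → v ~ y →
    3 + s ≤ m → Path G U v y m →
    ∃[ c ] Σ[ 3≤c ∈ 3 ≤ c ] Σ[ x ∈ Fin c ]
    (3 + (r + s) ≤ e (keyring 3≤c x r) × keyring 3≤c x r ⊑ G)
  path⇒keyring {U} {v} r s K≤deg v~y (s≤s 2+s≤m) (v∈U ~⟨ v~u ⟩ p)
    -- Only the part after `v` is truncated. It keeps at least `1 + s` edges, so the cycle through
    -- `v` has at least `3 + s` vertices, and it holds at most `2 + s` neighbours of `v`, leaving
    -- `r` for the leaves.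
    with truncate (v ~?_) (1 + s) p (≤-trans (n≤1+n (1 + s)) 2+s≤m) v~y
  ... | z , suc m , p′ , s≤s s≤m , v~z , hits≤
    with count-embed (offPath? v p′) (+-cancelʳ-≤ (2 + s) r (count (offPath? v p′))
           (let open ≤-Reasoning in begin
      r + (2 + s)                                 ≡⟨ trans (+-suc r (1 + s)) (cong suc (+-suc r s)) ⟩
      2 + (r + s)                                 ≤⟨ K≤deg ⟩
      deg G U v                                   ≤⟨ deg≤offPath+hits U v p′ ⟩
      count (offPath? v p′) + hits (v ~?_) p′     ≤⟨ +-monoʳ-≤ (count (offPath? v p′)) hits≤ ⟩
      count (offPath? v p′) + (2 + s)             ∎))
  ... | g , g-inj , g-off =
    _ , s≤s (s≤s (s≤s z≤n)) , zero ,
    ≤-trans (+-monoʳ-≤ 3 (≤-trans (+-monoʳ-≤ r s≤m) (≤-reflexive (+-comm r m)))) (keyring-edges m r) ,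
    keyring-⊑ (s≤s (s≤s z≤n)) (v∈U ~⟨ v~u ⟩ p′) (~-sym v~z) g g-inj (proj₁ ∘ g-off) off-cycle
    where
    off-cycle : ∀ i → ¬ OnPath (v∈U ~⟨ v~u ⟩ p′) (g i)
    off-cycle i (zero  , eq) = ~-irrefl eq (proj₁ (g-off i))
    off-cycle i (suc j , eq) = proj₂ (g-off i) (j , eq)

  dense⇒keyring : ∀ r s {S} → 3 + s ≤ r → Minimal (Dense (2 + (r + s))) S →
    ∃[ c ] Σ[ 3≤c ∈ 3 ≤ c ] Σ[ x ∈ Fin c ]
    (3 + (r + s) ≤ e (keyring 3≤c x r) × keyring 3≤c x r ⊑ G)
  dense⇒keyring r s {S} 3+s≤r minimal with minimal-dense⇒max-degree {1 + (r + s)} (proj₁ minimal)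
  ... | v , v∈S , K≤deg with count-witness (adjacentIn? G S v) (≤-trans (s≤s z≤n) K≤deg)
  ... | y , y∈S , v~y =
    let m , 3+s≤m , p = long-path G (2 + s) (minimal-dense⇒tight {2 + (r + s)} minimal y∈S) y∈S
                          (λ {u} u∈S _ → half (deg G S u) (minimal-dense⇒min-degree {2 + (r + s)} minimal u∈S))
                          v∈S (λ v≡y → ~-irrefl v≡y v~y)
    in path⇒keyring r s K≤deg v~y 3+s≤m p
    where
    open ≤-Reasoning
    -- Twice `k − r` is at most `k` since `k − r ≤ r`, while twice the degree is at least `k`.
    half : ∀ d → 2 + (r + s) < 2 * d → 3 + s ≤ d
    half d K<2d = *-cancelˡ-≤ 2 (begin
      2 * (3 + s)     ≡⟨ cong (3 + s +_) (+-identityʳ (3 + s)) ⟩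
      3 + s + (3 + s) ≤⟨ +-monoʳ-≤ (3 + s) 3+s≤r ⟩
      3 + s + r       ≡⟨ cong (3 +_) (+-comm s r) ⟩
      3 + (r + s)     ≤⟨ K<2d ⟩
      2 * d           ∎)

theorem3 : (k r : ℕ) → k ≤ 2 * r → r + 3 ≤ k →
    (n : ℕ) (G : Graph n) → (k ∸ 1) * n < 2 * e G →
    ∃[ c ] Σ[ 3≤c ∈ 3 ≤ c ] Σ[ v ∈ Fin c ]
    (k ≤ e (keyring 3≤c v r) × keyring 3≤c v r ⊑ G)
theorem3 k r k≤2r r+3≤k n G dense-G with m≤n⇒∃[o]m+o≡n (subst (_≤ k) (+-comm r 3) r+3≤k)
-- From here `k` is `3 + (r + s)` and `k − 1` is `2 + (r + s)`. The whole vertex set is dense, so it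
-- yields a minimal dense set.
... | s , refl = dense⇒keyring G r s 3+s≤r
  (proj₂ (minimal-exists (dense? G (2 + (r + s))) {⊤} (begin-strict
    (2 + (r + s)) * (size G ⊤ ∸ 1)
      ≤⟨ *-monoʳ-≤ (2 + (r + s)) {size G ⊤ ∸ 1} {n} (≤-trans (m∸n≤m (size G ⊤) 1) (count≤n (_∈? ⊤))) ⟩
    (2 + (r + s)) * n              <⟨ dense-G ⟩
    2 * e G                        ≤⟨ e≤degreeSum G ⟩
    degreeSum G ⊤                  ∎)))
  where
  open ≤-Reasoning
  3+s≤r : 3 + s ≤ r
  3+s≤r = +-cancelʳ-≤ r (3 + s) r (begin
    3 + s + r   ≡⟨ cong (3 +_) (+-comm s r) ⟩
    3 + (r + s) ≤⟨ k≤2r ⟩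
    2 * r       ≡⟨ cong (r +_) (+-identityʳ r) ⟩
    r + r       ∎)
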